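{- For each positive integer $k$, there exists a finite simple semi-transitively orientable graph $G$ with no odd cycle of length at most $2k+1$ such that $G$ has a pair of distinct non-adjacent vertices $u$ and $v$ for which $G+uv$ is not semi-transitively orientable.
   Context: Graphs are finite, undirected and simple. An orientation of a graph assigns to each edge one of its two directions; it is acyclic if it has no directed cycle. A digraph is transitive if whenever $v_1\to v_2$ and $v_2\to v_3$ are directed edges on three distinct vertices, $v_1\to v_3$ is also a directed edge. Given an acyclic orientation $\phi$ of a graph $G$, a shortcut in $\phi(G)$ is a non-transitive induced subdigraph of $\phi(G)$ on a vertex set $\{v_1,\dots,v_n\}$ with $n\ge 4$ (distinct vertices) that contains the directed path $v_1\to v_2\to\cdots\to v_n$ and the directed edge $v_1\to v_n$. An acyclic orientation $\phi$ is semi-transitive if $\phi(G)$ contains no shortcut, and a graph is semi-transitively orientable if it has a semi-transitive orientation. $G+uv$ denotes the graph obtained from $G$ by adding the edge $uv$. Cycles are subgraphs, not necessarily induced. -}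

module Defs where

open import Data.Fin using (Fin; zero; suc; inject₁; fromℕ; _≟_)
open import Data.Nat using (ℕ; suc; _≤_)
open import Data.Nat.Divisibility using (_∤_)
open import Data.Product using (Σ; _×_; _,_; swap)
open import Data.Sum using (_⊎_; inj₁; inj₂)
open import Function using (_on_)
open import Function.Definitions using (Injective)
open import Level using (0ℓ)
open import Relation.Binary using (Rel; Decidable; Symmetric; Irreflexive; Asymmetric)
open import Relation.Binary.PropositionalEquality using (_≡_; _≢_; sym; trans)
open import Relation.Nullary using (¬_)
open import Relation.Nullary.Decidable using (_⊎-dec_; _×-dec_)

record Graph (n : ℕ) : Set₁ where
  field
    Adj    : Rel (Fin n) 0ℓ
    adj?   : Decidable Adj
    symm   : Symmetric Adj
    irrefl : Irreflexive _≡_ Adj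

addEdge : ∀ {n} → Graph n → (u v : Fin n) → u ≢ v → Graph n
addEdge {n} G u v u≢v = record
  { Adj    = Adj⁺
  ; adj?   = λ x y → adj? x y ⊎-dec ((x ≟ u ×-dec y ≟ v) ⊎-dec (x ≟ v ×-dec y ≟ u))
  ; symm   = λ { (inj₁ e)        → inj₁ (symm e)
               ; (inj₂ (inj₁ p)) → inj₂ (inj₂ (swap p))
               ; (inj₂ (inj₂ p)) → inj₂ (inj₁ (swap p)) }
  ; irrefl = λ { x≡y (inj₁ e) → irrefl x≡y e
               ; x≡y (inj₂ (inj₁ (x≡u , y≡v))) → u≢v (trans (sym x≡u) (trans x≡y y≡v))
               ; x≡y (inj₂ (inj₂ (x≡v , y≡u))) → u≢v (trans (sym y≡u) (trans (sym x≡y) x≡v)) }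
  }
  where
  open Graph G
  Adj⁺ : Rel (Fin n) 0ℓ
  Adj⁺ x y = Adj x y ⊎ ((x ≡ u × y ≡ v) ⊎ (x ≡ v × y ≡ u))

-- ℓ counts edges, so there are suc ℓ distinct vertices.
record Path {V : Set} (R : Rel V 0ℓ) (ℓ : ℕ) : Set where
  field
    vertex   : Fin (suc ℓ) → V
    distinct : Injective _≡_ _≡_ vertex
    step     : (i : Fin ℓ) → R (vertex (inject₁ i)) (vertex (suc i))

  first last : V
  first = vertex zero
  last  = vertex (fromℕ ℓ)

-- A path with ℓ edges closed up by one more: a cycle of length suc ℓ.
-- Lengths 1 and 2 are not excluded here: an orientation has no directed
-- cycle of these lengths by asymmetry, and undirected cycles are
-- required to have length at least 3 where they are used.
record Cycle {V : Set} (R : Rel V 0ℓ) (ℓ : ℕ) : Set where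
  field
    path  : Path R ℓ
    close : R (Path.last path) (Path.first path)

NoOddCycleUpTo : ∀ {n} → ℕ → Graph n → Set
NoOddCycleUpTo b G =
  ∀ ℓ → 3 ≤ suc ℓ → suc ℓ ≤ b → 2 ∤ suc ℓ → ¬ Cycle (Graph.Adj G) ℓ

-- Decidability of _⇒_ follows from adj? together with these fields.
record Orientation {n : ℕ} (G : Graph n) : Set₁ where
  open Graph G
  field
    _⇒_    : Rel (Fin n) 0ℓ
    sound  : ∀ {x y} → x ⇒ y → Adj x y
    total  : ∀ {x y} → Adj x y → x ⇒ y ⊎ y ⇒ x
    asym   : Asymmetric _⇒_

Acyclic : {V : Set} → Rel V 0ℓ → Set
Acyclic R = ∀ ℓ → ¬ Cycle R ℓ

-- Weaker than the library's Transitive: only triples of distinct vertices.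
TransitiveDigraph : {V : Set} → Rel V 0ℓ → Set
TransitiveDigraph {V} R =
  ∀ {x y z : V} → x ≢ y → y ≢ z → x ≢ z → R x y → R y z → R x z

-- The induced subdigraph on the vertices of the path is represented on
-- their indices, by pulling R back along the injection vertex.
record Shortcut {V : Set} (R : Rel V 0ℓ) (ℓ : ℕ) : Set where
  field
    path          : Path R ℓ
    fourVertices  : 4 ≤ suc ℓ
    shortEdge     : R (Path.first path) (Path.last path)
    nonTransitive : ¬ TransitiveDigraph (R on Path.vertex path)

SemiTransitive : {V : Set} → Rel V 0ℓ → Set
SemiTransitive R = Acyclic R × (∀ ℓ → ¬ Shortcut R ℓ)

SemiTransitivelyOrientable : ∀ {n} → Graph n → Set₁
SemiTransitivelyOrientable G =
  Σ (Orientation G) λ φ → SemiTransitive (Orientation._⇒_ φ)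

{-# OPTIONS --safe #-}
-- Let H be a graph that is not 3-colourable and has no short odd closed walks,
-- and let G join the endpoints of every walk of length 3 in H.  An odd cycle of
-- G triples to an odd closed walk of H, so G has no short odd cycles either.
-- An acyclic orientation of G restricts to one of H, which by the Gallai–Roy
-- argument has a directed path with 3 edges; its endpoints are adjacent in G,
-- which yields a directed 4-cycle or a shortcut (G being triangle-free).  So G
-- is not semi-transitively orientable, while the edgeless graph is.  Inserting
-- the edges of G one at a time, orientability (a decidable property) is lost at
-- some insertion, and the graph just before it is the one sought.
--
-- For H we take a shift graph: decreasing tuples over a large alphabet, with
-- (x₀ , … , xₘ) joined to (w , x₀ , … , xₘ₋₁) for w > x₀.
module Submission where

open import Defs
open import Data.Bool using (if_then_else_)
open import Data.Empty using (⊥)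
open import Data.Fin using (Fin; zero; suc; toℕ; fromℕ; fromℕ<; inject₁; finToFun; funToFin) renaming (_<_ to _<ᶠ_; _>_ to _>ᶠ_; _≟_ to _≟ᶠ_; _<?_ to _<ᶠ?_)
open import Data.Fin.Properties using (any?; all?; finToFun-funToFin; pigeonhole; injective⇒≤; toℕ-injective; toℕ-fromℕ<; toℕ-inject₁) renaming (<-cmp to <ᶠ-cmp; <-trans to <ᶠ-trans; <-irrefl to <ᶠ-irrefl)
open import Data.List using (List; []; _∷_; allFin; cartesianProduct)
open import Data.List.Membership.Propositional using (_∈_)
open import Data.List.Membership.Propositional.Properties using (∈-cartesianProduct⁺; ∈-allFin)
open import Data.List.Relation.Unary.Any using (here; there)
open import Data.Nat using (ℕ; zero; suc; _+_; _*_; _^_; _≤_; _<_; z≤n; s≤s; s<s; z<s; _≤?_)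
open import Data.Nat.Divisibility using (_∣_; _∣?_; divides)
open import Data.Nat.Primality using (euclidsLemma; prime[2])
open import Data.Nat.Properties using (suc-injective; +-suc; +-assoc; +-comm; +-identityʳ; *-comm; *-suc; *-monoʳ-≤; +-monoˡ-≤; m≤m+n; m≤n+m; m<n+m; ≤-refl; ≤-trans; <-cmp; n<1+n; allUpTo?; module ≤-Reasoning)
open import Data.Product using (Σ; ∃; ∃₂; _×_; _,_; proj₁; proj₂)
open import Data.Sum as Sum using (_⊎_; inj₁; inj₂; [_,_]′; swap)
open import Data.Vec.Functional using (Vector) renaming (_∷_ to _∷ᵛ_; [] to []ᵛ)
open import Function using (_∘_; _on_; id)
open import Level using (0ℓ)
open import Relation.Binary using (Rel; Decidable; Symmetric; _⇒_; _Preserves_⟶_; tri<; tri≈; tri>)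
open import Relation.Binary.PropositionalEquality using (_≡_; _≢_; _≗_; refl; sym; trans; cong; subst; subst₂)
open import Relation.Nullary using (¬_; Dec; yes; no; does; contradiction; ¬?)
open import Relation.Nullary.Decidable using (map′; _×-dec_; _⊎-dec_; _→-dec_; from-no; dec-true)
import Relation.Unary as Unary

private variable
  m n c ℓ : ℕ

-- Exhaustive search over functions and relations on finite sets

-- The search runs over codes, and a function agrees with its decoded code only pointwise, so `P`
-- has to respect `≗`.
anyFunction? : {P : (Fin m → Fin n) → Set} → (∀ {f g} → f ≗ g → P f → P g) →
  Unary.Decidable P → Dec (∃ P)
anyFunction? resp P? = map′
  (λ (i , p) → finToFun i , p)
  (λ (f , p) → funToFin f , resp (sym ∘ finToFun-funToFin f) p)
  (any? (P? ∘ finToFun))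

-- Subsets are coded by numbers whose base-2 digits form the characteristic function. These codes
-- also serve as colours of shift graphs.
Member : Fin (2 ^ n) → Fin n → Set
Member {n} s i = finToFun {2} {n} s i ≡ suc zero

member? : (s : Fin (2 ^ n)) → Unary.Decidable (Member {n} s)
member? {n} s i = finToFun {2} {n} s i ≟ᶠ suc zero

module _ {P : Fin n → Set} (P? : Unary.Decidable P) where

  private
    indicator : Fin n → Fin 2
    indicator i = if does (P? i) then suc zero else zero

  subsetCode : Fin (2 ^ n)
  subsetCode = funToFin indicator

  subsetCode⁺ : ∀ {i} → P i → Member {n} subsetCode i
  subsetCode⁺ {i} p = trans (finToFun-funToFin indicator i)
    (cong (if_then suc zero else zero) (dec-true (P? i) p))

  subsetCode⁻ : ∀ {i} → Member {n} subsetCode i → P i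
  subsetCode⁻ {i} mem with P? i | trans (sym (finToFun-funToFin indicator i)) mem
  ... | yes p | _ = p

Related : Fin ((2 ^ n) ^ n) → Rel (Fin n) 0ℓ
Related {n} r x = Member {n} (finToFun {2 ^ n} {n} r x)

related? : (r : Fin ((2 ^ n) ^ n)) → Decidable (Related {n} r)
related? {n} r x = member? {n} (finToFun {2 ^ n} {n} r x)

module _ {R : Rel (Fin n) 0ℓ} (R? : Decidable R) where

  relationCode : Fin ((2 ^ n) ^ n)
  relationCode = funToFin (λ x → subsetCode (R? x))

  relationCode⁺ : R ⇒ Related {n} relationCode
  relationCode⁺ {x} {y} = subst (λ s → Member {n} s y)
    (sym (finToFun-funToFin (λ x → subsetCode (R? x)) x)) ∘ subsetCode⁺ (R? x)

  relationCode⁻ : Related {n} relationCode ⇒ R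
  relationCode⁻ {x} {y} = subsetCode⁻ (R? x) ∘ subst (λ s → Member {n} s y)
    (finToFun-funToFin (λ x → subsetCode (R? x)) x)

-- Semi-transitivity is decidable

mapPath : {V : Set} {R S : Rel V 0ℓ} → R ⇒ S → Path R ℓ → Path S ℓ
mapPath f p = record { vertex = vertex ; distinct = distinct ; step = f ∘ step }
  where open Path p

mapCycle : {V : Set} {R S : Rel V 0ℓ} → R ⇒ S → Cycle R ℓ → Cycle S ℓ
mapCycle f c = record { path = mapPath f path ; close = f close }
  where open Cycle c

-- Semi-transitivity is not monotone: cycles and paths are pulled back along `g`, but
-- non-transitivity also depends on absent edges, which calls for `f`.
mapSemiTransitive : {V : Set} {R S : Rel V 0ℓ} → R ⇒ S → S ⇒ R → SemiTransitive R → SemiTransitive S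
mapSemiTransitive f g (acyclic , noShortcut) = (λ ℓ → acyclic ℓ ∘ mapCycle g) , λ ℓ s →
  let open Shortcut s in noShortcut ℓ record
    { path          = mapPath g path
    ; fourVertices  = fourVertices
    ; shortEdge     = g shortEdge
    ; nonTransitive = λ t → nonTransitive λ x≢y y≢z x≢z xy yz → f (t x≢y y≢z x≢z (g xy) (g yz))
    }

path-short : {R : Rel (Fin n) 0ℓ} → Path R ℓ → ℓ < n
path-short p = injective⇒≤ (Path.distinct p)

module _ {R : Rel (Fin n) 0ℓ} (R? : Decidable R) where

  somePath? : {Q : (Fin (suc ℓ) → Fin n) → Set} → (∀ {v w} → v ≗ w → Q v → Q w) →
    Unary.Decidable Q → Dec (Σ (Path R ℓ) (Q ∘ Path.vertex))
  somePath? {ℓ} {Q} Q-resp Q? = map′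
    (λ (v , (inj , st) , q) → record { vertex = v ; distinct = λ {i} {j} → inj i j ; step = st } , q)
    (λ (p , q) → Path.vertex p , ((λ _ _ → Path.distinct p) , Path.step p) , q)
    (anyFunction? resp (λ v → isPath? v ×-dec Q? v))
    where
    IsPath : (Fin (suc ℓ) → Fin n) → Set
    IsPath v = (∀ i j → v i ≡ v j → i ≡ j) × (∀ i → R (v (inject₁ i)) (v (suc i)))

    isPath? : Unary.Decidable IsPath
    isPath? v = all? (λ i → all? λ j → (v i ≟ᶠ v j) →-dec (i ≟ᶠ j)) ×-dec all? (λ i → R? _ _)

    resp : ∀ {v w} → v ≗ w → IsPath v × Q v → IsPath w × Q w
    resp v≗w ((inj , st) , q) =
      ((λ i j e → inj i j (trans (v≗w i) (trans e (sym (v≗w j))))) ,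
       (λ i → subst₂ R (v≗w _) (v≗w _) (st i))) , Q-resp v≗w q

  cycle? : ∀ ℓ → Dec (Cycle R ℓ)
  cycle? ℓ = map′
    (λ (p , e) → record { path = p ; close = e })
    (λ c → Cycle.path c , Cycle.close c)
    (somePath? (λ e → subst₂ R (e _) (e _)) (λ _ → R? _ _))

  transitiveDigraph? : (v : Fin m → Fin n) → Dec (TransitiveDigraph (R on v))
  transitiveDigraph? v = map′ (λ t → t _ _ _) (λ t _ _ _ → t)
    (all? λ x → all? λ y → all? λ z →
      ¬? (x ≟ᶠ y) →-dec ¬? (y ≟ᶠ z) →-dec ¬? (x ≟ᶠ z) →-dec
      R? _ _ →-dec R? _ _ →-dec R? _ _)

  shortcut? : ∀ ℓ → Dec (Shortcut R ℓ)
  shortcut? ℓ = map′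
    (λ (p , four , e , nt) → record { path = p ; fourVertices = four ; shortEdge = e ; nonTransitive = nt })
    (λ s → let open Shortcut s in path , fourVertices , shortEdge , nonTransitive)
    (somePath?
      (λ e (four , se , nt) → four , subst₂ R (e _) (e _) se , λ t → nt λ x≢y y≢z x≢z xy yz →
        subst₂ R (sym (e _)) (sym (e _))
          (t x≢y y≢z x≢z (subst₂ R (e _) (e _) xy) (subst₂ R (e _) (e _) yz)))
      (λ v → (4 ≤? suc ℓ) ×-dec R? _ _ ×-dec ¬? (transitiveDigraph? v)))

  -- Cycles and shortcuts contain paths with distinct vertices, so only finitely many lengths need
  -- checking.
  none? : {X : ℕ → Set} → (∀ ℓ → X ℓ → ℓ < n) → Unary.Decidable X → Dec (∀ ℓ → ¬ X ℓ)
  none? {X} short X? = map′ {A = ∀ {ℓ} → ℓ < n → ¬ X ℓ}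
    (λ none ℓ x → none (short ℓ x) x)
    (λ none _ → none _)
    (allUpTo? (¬? ∘ X?) n)

  semiTransitive? : Dec (SemiTransitive R)
  semiTransitive? =
    none? (λ _ → path-short ∘ Cycle.path) cycle? ×-dec
    none? (λ _ → path-short ∘ Shortcut.path) shortcut?

module _ (G : Graph n) where
  open Graph G

  orientation? : (φ : Orientation G) → Decidable (Orientation._⇒_ φ)
  orientation? φ x y with adj? x y
  ... | no ¬xy = no (¬xy ∘ Orientation.sound φ)
  ... | yes xy with Orientation.total φ xy
  ...   | inj₁ x⇒y = yes x⇒y
  ...   | inj₂ y⇒x = no (Orientation.asym φ y⇒x)

  private
    Good : Rel (Fin n) 0ℓ → Set
    Good R = (∀ x y → R x y → Adj x y) × (∀ x y → Adj x y → R x y ⊎ R y x) ×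
             (∀ x y → R x y → ¬ R y x) × SemiTransitive R

    good? : {R : Rel (Fin n) 0ℓ} → Decidable R → Dec (Good R)
    good? R? = all? (λ x → all? λ y → R? x y →-dec adj? x y)
      ×-dec all? (λ x → all? λ y → adj? x y →-dec (R? x y ⊎-dec R? y x))
      ×-dec all? (λ x → all? λ y → R? x y →-dec ¬? (R? y x))
      ×-dec semiTransitive? R?

  orientable? : Dec (SemiTransitivelyOrientable G)
  orientable? = map′ to from (any? (λ r → good? (related? {n} r)))
    where
    to : ∃ (λ r → Good (Related {n} r)) → SemiTransitivelyOrientable G
    to (r , so , to , as , st) = record
      { _⇒_ = Related {n} r ; sound = so _ _ ; total = to _ _ ; asym = as _ _ } , st

    from : SemiTransitivelyOrientable G → ∃ (λ r → Good (Related {n} r))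
    from (φ , st) = relationCode R? ,
      (λ _ _ → sound ∘ R⁻) ,
      (λ _ _ → Sum.map R⁺ R⁺ ∘ total) ,
      (λ _ _ xy yx → asym (R⁻ xy) (R⁻ yx)) ,
      mapSemiTransitive R⁺ R⁻ st
      where
      open Orientation φ using (sound; total; asym)
      R? = orientation? φ
      R⁺ = relationCode⁺ R?
      R⁻ = relationCode⁻ R?

-- Edge-critical subgraphs

_⊆_ : Graph n → Graph n → Set
G ⊆ H = Graph.Adj G ⇒ Graph.Adj H

mapOrientable : {G H : Graph n} → G ⊆ H → H ⊆ G → SemiTransitivelyOrientable G → SemiTransitivelyOrientable H
mapOrientable f g (φ , st) = record
  { _⇒_ = _⇒ᵩ_ ; sound = f ∘ sound ; total = total ∘ g ; asym = asym } , st
  where open Orientation φ renaming (_⇒_ to _⇒ᵩ_)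

edgeless : Graph n
edgeless = record { Adj = λ _ _ → ⊥ ; adj? = λ _ _ → no id ; symm = id ; irrefl = λ _ () }

edgeless-orientable : SemiTransitivelyOrientable (edgeless {n})
edgeless-orientable = record { _⇒_ = λ _ _ → ⊥ ; sound = id ; total = λ () ; asym = λ () } ,
  (λ _ → Cycle.close) , (λ _ → Shortcut.shortEdge)

module _ (G : Graph n) where
  open Graph G

  private
    distinct : ∀ {x y} → Adj x y → x ≢ y
    distinct xy x≡y = irrefl x≡y xy

  insertEdges : List (Fin n × Fin n) → Graph n
  insertEdges [] = edgeless
  insertEdges ((u , v) ∷ es) with adj? u v
  ... | yes uv = addEdge (insertEdges es) u v (distinct uv)
  ... | no  _  = insertEdges es

  insertEdges-⊆ : ∀ es → insertEdges es ⊆ G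
  insertEdges-⊆ ((u , v) ∷ es) e with adj? u v
  insertEdges-⊆ ((u , v) ∷ es) e                           | no  _  = insertEdges-⊆ es e
  insertEdges-⊆ ((u , v) ∷ es) (inj₁ e)                    | yes _  = insertEdges-⊆ es e
  insertEdges-⊆ ((u , v) ∷ es) (inj₂ (inj₁ (refl , refl))) | yes uv = uv
  insertEdges-⊆ ((u , v) ∷ es) (inj₂ (inj₂ (refl , refl))) | yes uv = symm uv

  insertEdges-⊇ : ∀ {es x y} → (x , y) ∈ es → Adj x y → Graph.Adj (insertEdges es) x y
  insertEdges-⊇ {(u , v) ∷ es} p xy with adj? u v
  insertEdges-⊇ (here refl) xy | yes _  = inj₂ (inj₁ (refl , refl))
  insertEdges-⊇ (here refl) xy | no ¬xy = contradiction xy ¬xy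
  insertEdges-⊇ (there p)   xy | yes _  = inj₁ (insertEdges-⊇ p xy)
  insertEdges-⊇ (there p)   xy | no  _  = insertEdges-⊇ p xy

  -- `H ⊆ G` is recorded because the absence of short odd cycles passes to subgraphs.
  Critical : Graph n → Set₁
  Critical H = SemiTransitivelyOrientable H × H ⊆ G ×
    (Σ (Fin n) λ u → Σ (Fin n) λ v → Σ (u ≢ v) λ u≢v →
      ¬ Graph.Adj H u v × ¬ SemiTransitivelyOrientable (addEdge H u v u≢v))

  -- If orientability already fails for the tail, recurse; otherwise the head edge destroys it. The
  -- empty list is excluded, the edgeless graph being orientable.
  insertEdges-critical : ∀ es → ¬ SemiTransitivelyOrientable (insertEdges es) → Σ (Graph n) Critical
  insertEdges-critical [] ¬sto = contradiction edgeless-orientable ¬sto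
  insertEdges-critical ((u , v) ∷ es) ¬sto with adj? u v
  ... | no _ = insertEdges-critical es ¬sto
  ... | yes uv with orientable? (insertEdges es)
  ...   | no ¬sto′ = insertEdges-critical es ¬sto′
  ...   | yes sto = insertEdges es , sto , insertEdges-⊆ es , u , v , distinct uv ,
    -- If `uv` were already present, as after inserting the reversed pair, adding it would not
    -- change adjacency and orientability would survive.
    (λ e → ¬sto (mapOrientable inj₁
      (λ { (inj₁ e′)                   → e′
         ; (inj₂ (inj₁ (refl , refl))) → e
         ; (inj₂ (inj₂ (refl , refl))) → Graph.symm (insertEdges es) e })
      sto)) , ¬sto

  criticalSubgraph : ¬ SemiTransitivelyOrientable G → Σ (Graph n) Critical
  criticalSubgraph ¬sto = insertEdges-critical allPairs
    (¬sto ∘ mapOrientable (insertEdges-⊆ allPairs)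
      (λ {x} {y} → insertEdges-⊇ (∈-cartesianProduct⁺ (∈-allFin x) (∈-allFin y))))
    where allPairs = cartesianProduct (allFin n) (allFin n)

-- Directed paths in graphs that are not 3-colourable

Colouring : {V : Set} → Rel V 0ℓ → ℕ → Set
Colouring {V} E c = Σ (V → Fin c) λ f → ∀ {x y} → E x y → f x ≢ f y

-- A vertex is coloured by the length, capped at 2, of a longest walk leaving it.
gallaiRoy₃ : {D : Rel (Fin n) 0ℓ} → Decidable D →
  (∀ {x y z w} → D x y → D y z → ¬ D z w) → Colouring D 3
gallaiRoy₃ {n} {D} D? noWalk = colour , proper
  where
  Leaves₁ Leaves₂ : Fin n → Set
  Leaves₁ x = ∃ λ y → D x y
  Leaves₂ x = ∃ λ y → D x y × Leaves₁ y

  leaves₁? : Unary.Decidable Leaves₁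
  leaves₁? x = any? (D? x)

  leaves₂? : Unary.Decidable Leaves₂
  leaves₂? x = any? λ y → D? x y ×-dec leaves₁? y

  colour : Fin n → Fin 3
  colour x with leaves₂? x | leaves₁? x
  ... | yes _ | _     = suc (suc zero)
  ... | no _  | yes _ = suc zero
  ... | no _  | no _  = zero

  proper : ∀ {x y} → D x y → colour x ≢ colour y
  proper {x} {y} xy with leaves₂? x | leaves₁? x | leaves₂? y | leaves₁? y
  -- Prefixing `xy` to a walk leaving `y` gives a longer walk leaving `x`, so the colour of `x` is
  -- strictly larger.
  ... | _     | _     | yes (z , yz , w , zw) | _ = contradiction zw (noWalk xy yz)
  ... | no ¬2 | _     | no _ | yes 1y = contradiction (y , xy , 1y) ¬2
  ... | no _  | no ¬1 | no _ | no _   = contradiction (y , xy) ¬1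
  ... | yes _ | _     | no _ | yes _  = λ ()
  ... | yes _ | _     | no _ | no _   = λ ()
  ... | no _  | yes _ | no _ | no _   = λ ()

path₃ : {V : Set} {R : Rel V 0ℓ} {x y z w : V} →
  x ≢ y → x ≢ z → x ≢ w → y ≢ z → y ≢ w → z ≢ w →
  R x y → R y z → R z w → Path R 3
path₃ {x = x} {y} {z} {w} x≢y x≢z x≢w y≢z y≢w z≢w xy yz zw = record
  { vertex   = v
  ; distinct = λ {i} {j} → injective i j
  ; step     = λ { zero → xy ; (suc zero) → yz ; (suc (suc zero)) → zw }
  }
  where
  v = x ∷ᵛ y ∷ᵛ z ∷ᵛ w ∷ᵛ []ᵛ

  apart : ∀ i j → i <ᶠ j → v i ≢ v j
  apart zero                   (suc zero)             _ = x≢y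
  apart zero                   (suc (suc zero))       _ = x≢z
  apart zero                   (suc (suc (suc zero))) _ = x≢w
  apart (suc zero)             (suc (suc zero))       _ = y≢z
  apart (suc zero)             (suc (suc (suc zero))) _ = y≢w
  apart (suc (suc zero))       (suc (suc (suc zero))) _ = z≢w
  apart (suc zero)             (suc zero)             (s<s ())
  apart (suc (suc zero))       (suc zero)             (s<s ())
  apart (suc (suc zero))       (suc (suc zero))       (s<s (s<s ()))
  apart (suc (suc (suc zero))) (suc zero)             (s<s ())
  apart (suc (suc (suc zero))) (suc (suc zero))       (s<s (s<s ()))
  apart (suc (suc (suc zero))) (suc (suc (suc zero))) (s<s (s<s (s<s ())))

  injective : ∀ i j → v i ≡ v j → i ≡ j
  injective i j e with <ᶠ-cmp i j
  ... | tri< i<j _ _ = contradiction e (apart i j i<j)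
  ... | tri≈ _ i≡j _ = i≡j
  ... | tri> _ _ j<i = contradiction (sym e) (apart j i j<i)

module _ (G : Graph n) (E : Rel (Fin n) 0ℓ) (E? : Decidable E) (E-sym : Symmetric E)
  (triangleFree : ∀ {x y z} → Graph.Adj G x y → Graph.Adj G y z → ¬ Graph.Adj G z x)
  (ends-adjacent : ∀ {x y z w} → E x y → E y z → E z w → Graph.Adj G x w) where

  open Graph G

  private
    -- Going along an edge, back and along it again is a walk of length 3 with the same ends.
    E⊆Adj : E ⇒ Adj
    E⊆Adj xy = ends-adjacent xy (E-sym xy) xy

  orientable⇒3-colourable : SemiTransitivelyOrientable G → Colouring E 3
  orientable⇒3-colourable (φ , acyclic , noShortcut) = colour , proper
    where
    open Orientation φ renaming (_⇒_ to _↝_)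

    D : Rel (Fin n) 0ℓ
    D x y = E x y × x ↝ y

    noWalk : ∀ {x y z w} → D x y → D y z → ¬ D z w
    noWalk {x} {y} {z} {w} (xy , x↝y) (yz , y↝z) (zw , z↝w) = [ shortcut , directedCycle ]′ (total xw)
      where
      xw = ends-adjacent xy yz zw

      -- `x = z` or `y = w` would orient one edge both ways; all other pairs are adjacent in `G`.
      path = path₃ (λ e → irrefl e (E⊆Adj xy)) (λ { refl → asym x↝y y↝z }) (λ e → irrefl e xw)
                   (λ e → irrefl e (E⊆Adj yz)) (λ { refl → asym y↝z z↝w })
                   (λ e → irrefl e (E⊆Adj zw)) x↝y y↝z z↝w

      shortcut : ¬ x ↝ w
      shortcut x↝w = noShortcut 3 record
        { path          = path
        ; fourVertices  = ≤-refl
        ; shortEdge     = x↝w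
        ; nonTransitive = λ t → triangleFree (E⊆Adj xy) (E⊆Adj yz)
            (symm (sound (t {zero} {suc zero} {suc (suc zero)} (λ ()) (λ ()) (λ ()) x↝y y↝z)))
        }

      directedCycle : ¬ w ↝ x
      directedCycle w↝x = acyclic 3 record { path = path ; close = w↝x }

    D-colouring : Colouring D 3
    D-colouring = gallaiRoy₃ (λ x y → E? x y ×-dec orientation? G φ x y) noWalk

    colour = proj₁ D-colouring

    proper : ∀ {x y} → E x y → colour x ≢ colour y
    proper xy with total (E⊆Adj xy)
    ... | inj₁ x↝y = proj₂ D-colouring (xy , x↝y)
    ... | inj₂ y↝x = proj₂ D-colouring (E-sym xy , y↝x) ∘ sym

-- Shift graphs

Decreasing : Vector (Fin n) m → Set
Decreasing x = x Preserves _<ᶠ_ ⟶ _>ᶠ_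

decreasing? : (x : Vector (Fin n) m) → Dec (Decreasing x)
decreasing? x = map′ (λ d → d _ _) (λ d _ _ → d)
  (all? λ i → all? λ j → (i <ᶠ? j) →-dec (x j <ᶠ? x i))

-- Both ends are windows of one decreasing tuple with one more entry. All tuples are vertices; those
-- that are not decreasing are isolated.
Shift : Rel (Vector (Fin n) (suc m)) 0ℓ
Shift x y = Decreasing (y zero ∷ᵛ x) × (∀ i → y (suc i) ≡ x (inject₁ i))

shift? : Decidable (Shift {n} {m})
shift? x y = decreasing? (y zero ∷ᵛ x) ×-dec all? (λ i → y (suc i) ≟ᶠ x (inject₁ i))

decreasing-resp : {x y : Vector (Fin n) m} → x ≗ y → Decreasing x → Decreasing y
decreasing-resp x≗y d {i} {j} i<j = subst₂ _<ᶠ_ (x≗y j) (x≗y i) (d i<j)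

shift-resp : {x x′ y y′ : Vector (Fin n) (suc m)} → x ≗ x′ → y ≗ y′ → Shift x y → Shift x′ y′
shift-resp x≗ y≗ (d , s) =
  decreasing-resp (λ { zero → y≗ zero ; (suc i) → x≗ i }) d ,
  λ i → trans (sym (y≗ (suc i))) (trans (s i) (x≗ (inject₁ i)))

shift⇒decreasingˡ : {x y : Vector (Fin n) (suc m)} → Shift x y → Decreasing x
shift⇒decreasingˡ (d , _) i<j = d (s<s i<j)

shift⇒decreasingʳ : {x y : Vector (Fin n) (suc m)} → Shift x y → Decreasing y
shift⇒decreasingʳ {x = x} {y} (d , s) =
  decreasing-resp {y = y} (λ { zero → refl ; (suc i) → sym (s i) })
    (λ {i} {j} i<j → d (subst₂ _<_ (sym (toℕ-inject₁ i)) (sym (toℕ-inject₁ j)) i<j))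

-- A tuple is coloured by the set of colours of its one-entry extensions.
shift-colouring-step : Colouring (Shift {n} {suc m}) c → Colouring (Shift {n} {m}) (2 ^ c)
shift-colouring-step {n} {m} {c} (f , proper) = g , g-proper
  where
  Extends : Vector (Fin n) (suc m) → Fin c → Fin n → Set
  Extends x a w = Decreasing (w ∷ᵛ x) × f (w ∷ᵛ x) ≡ a

  extension? : ∀ x → Unary.Decidable (λ a → ∃ (Extends x a))
  extension? x a = any? λ w → decreasing? (w ∷ᵛ x) ×-dec (f (w ∷ᵛ x) ≟ᶠ a)

  g : Vector (Fin n) (suc m) → Fin (2 ^ c)
  g x = subsetCode (extension? x)

  g-proper : ∀ {x y} → Shift x y → g x ≢ g y
  g-proper {x} {y} (d , s) gx≡gy
    -- The colour of `y zero ∷ᵛ x` lies in `g x`, hence in `g y`, so some `w ∷ᵛ y` has it too; yet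
    -- these two tuples are joined by a shift.
    with w , d′ , eq ← subsetCode⁻ (extension? y)
      (subst (λ a → Member {c} a (f (y zero ∷ᵛ x))) gx≡gy (subsetCode⁺ (extension? x) (y zero , d , refl)))
    = proper (d″ , λ { zero → refl ; (suc i) → s i }) (sym eq)
    where
    w>y₀ : y zero <ᶠ w
    w>y₀ = d′ {zero} {suc zero} z<s

    d″ : Decreasing (w ∷ᵛ y zero ∷ᵛ x)
    d″ {zero}  {suc zero}    _         = w>y₀
    d″ {zero}  {suc (suc j)} _         = <ᶠ-trans (d {zero} {suc j} z<s) w>y₀
    d″ {suc i} {suc j}       (s<s i<j) = d i<j

-- Each further entry lowers the number of excluded colours from `2 ^ c` to `c`. Single entries form
-- a complete graph, where the pigeonhole principle applies.
shift-uncolourable : ∀ m c → ∃ λ n → ¬ Colouring (Shift {n} {m}) c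
shift-uncolourable (suc m) c with n , ¬col ← shift-uncolourable m (2 ^ c) =
  n , ¬col ∘ shift-colouring-step
shift-uncolourable zero c = suc c , λ (f , proper) →
  let i , j , i<j , e = pigeonhole (n<1+n c) (λ a → f (λ _ → a)) in
  proper ((λ { {zero} {suc zero} _ → i<j ; {suc zero} {suc zero} (s<s ()) }) , λ ()) e

-- Parity of closed walks in shift graphs

_∼_ : Rel (Vector (Fin n) (suc m)) 0ℓ
x ∼ y = Shift x y ⊎ Shift y x

∼⇒decreasing : {x y : Vector (Fin n) (suc m)} → x ∼ y → Decreasing x
∼⇒decreasing {x = x} {y} (inj₁ s) = shift⇒decreasingˡ {x = x} {y} s
∼⇒decreasing {x = x} {y} (inj₂ s) = shift⇒decreasingʳ {x = y} {x} s

-- What a walk from x to y with a backward and b forward steps preserves: the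
-- entries of x that cannot be shifted out of the tuple by a + b steps.
Displaced : ℕ → ℕ → Rel (Vector (Fin n) (suc m)) 0ℓ
Displaced {m = m} a b x y = ∀ r i j → r + (a + b) ≤ m → toℕ i ≡ b + r → toℕ j ≡ a + r → y i ≡ x j

-- Intermediate vertices are forgotten; the step counts and the surviving entries suffice for
-- parity.
Walk : ℕ → Rel (Vector (Fin n) (suc m)) 0ℓ
Walk ℓ x y = ∃₂ λ a b → a + b ≡ ℓ × Displaced a b x y

nil : {x : Vector (Fin n) (suc m)} → Walk 0 x x
nil {x = x} = 0 , 0 , refl , λ r i j _ i≡r j≡r → cong x (toℕ-injective (trans i≡r (sym j≡r)))

snoc : {x y z : Vector (Fin n) (suc m)} → Walk ℓ x y → y ∼ z → Walk (suc ℓ) x z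
snoc {m = m} {x = x} {y} {z} (a , b , refl , disp) (inj₁ (_ , s)) = a , suc b , +-suc a b , disp′
  where
  disp′ : Displaced a (suc b) x z
  -- The entry at `suc i` in `z` stood at `i` in `y`, so `r` stays the same while `b` grows.
  disp′ r (suc i) j bound i≡ j≡ = trans (s i)
    (disp r (inject₁ i) j
      (≤-trans (m≤n+m _ 1) (subst (_≤ m) (trans (cong (r +_) (+-suc a b)) (+-suc r (a + b))) bound))
      (trans (toℕ-inject₁ i) (suc-injective i≡)) j≡)
snoc {m = m} {x = x} {y} {z} (a , b , refl , disp) (inj₂ (_ , s)) = suc a , b , refl , disp′
  where
  disp′ : Displaced (suc a) b x z
  -- The entry at `i` in `z` stood one place further right in `y`, so `r` grows by one; the bound
  -- ensures that this place exists.
  disp′ r i j bound i≡ j≡ = trans (cong z (toℕ-injective (sym i′≡i)))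
    (trans (sym (s i′)) (disp (suc r) (suc i′) j (subst (_≤ m) (+-suc r (a + b)) bound)
      (trans (cong suc (trans (toℕ-fromℕ< i<m) i≡)) (sym (+-suc b r)))
      (trans j≡ (sym (+-suc a r)))))
    where
    i<m : toℕ i < m
    i<m = begin-strict
      toℕ i           ≡⟨ i≡ ⟩
      b + r           <⟨ m<n+m (b + r) {suc a} z<s ⟩
      suc a + (b + r) ≡⟨ +-assoc (suc a) b r ⟨
      suc a + b + r   ≡⟨ +-comm (suc a + b) r ⟩
      r + (suc a + b) ≤⟨ bound ⟩
      m               ∎
      where
      open ≤-Reasoning
    i′ : Fin m
    i′ = fromℕ< i<m
    i′≡i : toℕ (inject₁ i′) ≡ toℕ i
    i′≡i = trans (toℕ-inject₁ i′) (toℕ-fromℕ< i<m)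

-- Taking `r = 0` gives equal entries of `x` at positions `b` and `a`; a decreasing tuple has no
-- repeated entries, so `a = b`.
closedWalk-even : {x : Vector (Fin n) (suc m)} → Walk ℓ x x → Decreasing x → ℓ ≤ m → 2 ∣ ℓ
closedWalk-even {m = m} {x = x} (a , b , refl , disp) d bound = even
  where
  a′ b′ : Fin (suc m)
  a′ = fromℕ< (s≤s (≤-trans (m≤m+n a b) bound))
  b′ = fromℕ< (s≤s (≤-trans (m≤n+m b a) bound))

  a′≡a : toℕ a′ ≡ a
  a′≡a = toℕ-fromℕ< _

  b′≡b : toℕ b′ ≡ b
  b′≡b = toℕ-fromℕ< _

  x[b]≡x[a] : x b′ ≡ x a′
  x[b]≡x[a] = disp 0 b′ a′ bound
    (trans b′≡b (sym (+-identityʳ b))) (trans a′≡a (sym (+-identityʳ a)))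

  even : 2 ∣ a + b
  even with <-cmp a b
  ... | tri≈ _ refl _ = divides a (trans (cong (a +_) (sym (+-identityʳ a))) (*-comm 2 a))
  ... | tri< a<b _ _  =
    contradiction (d (subst₂ _<_ (sym a′≡a) (sym b′≡b) a<b)) (<ᶠ-irrefl x[b]≡x[a])
  ... | tri> _ _ b<a  =
    contradiction (d (subst₂ _<_ (sym b′≡b) (sym a′≡a) b<a)) (<ᶠ-irrefl (sym x[b]≡x[a]))

-- The graph joining the endpoints of the walks of length 3 in a shift graph

module Tripled (n b : ℕ) (3≤b : 3 ≤ b) where

  private
    -- A closed walk of `ℓ ≤ b` edges triples to at most `3 * b` steps, the longest that
    -- `closedWalk-even` allows.
    size = 3 * b

    tuple : Fin (n ^ suc size) → Vector (Fin n) (suc size)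
    tuple = finToFun

  E : Rel (Fin (n ^ suc size)) 0ℓ
  E = _∼_ on tuple

  E? : Decidable E
  E? p q = shift? (tuple p) (tuple q) ⊎-dec shift? (tuple q) (tuple p)

  E-sym : Symmetric E
  E-sym = swap

  Adj₃ : Rel (Fin (n ^ suc size)) 0ℓ
  Adj₃ p q = ∃₂ λ r s → E p r × E r s × E s q

  snoc₃ : ∀ ℓ {v p q} → Walk (3 * ℓ) v (tuple p) → Adj₃ p q → Walk (3 * suc ℓ) v (tuple q)
  snoc₃ ℓ {v} {_} {q} w (r , s , pr , rs , sq) =
    subst (λ k → Walk k v (tuple q)) (sym (*-suc 3 ℓ)) (snoc (snoc (snoc w pr) rs) sq)

  -- As 2 does not divide 3, evenness of `3 * ℓ` passes to `ℓ`. The edge into `p` shows that its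
  -- tuple is decreasing.
  closedWalk₃-even : ∀ {p q} → Adj₃ q p → Walk (3 * ℓ) (tuple p) (tuple p) → ℓ ≤ b → 2 ∣ ℓ
  closedWalk₃-even {ℓ} (_ , _ , _ , _ , sp) w ℓ≤b =
    [ (λ 2∣3 → contradiction 2∣3 (from-no (2 ∣? 3))) , id ]′
      (euclidsLemma 3 ℓ prime[2] (closedWalk-even w (∼⇒decreasing (swap sp)) (*-monoʳ-≤ 3 ℓ≤b)))

  graph : Graph (n ^ suc size)
  graph = record
    { Adj    = Adj₃
    ; adj?   = λ p q → any? λ r → any? λ s → E? p r ×-dec E? r s ×-dec E? s q
    ; symm   = λ (r , s , pr , rs , sq) → s , r , E-sym sq , E-sym rs , E-sym pr
    -- A loop would be a closed walk with `ℓ = 1`, which is odd and at most `b`.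
    ; irrefl = λ { refl pp → contradiction
        (closedWalk₃-even {1} pp (snoc₃ 0 nil pp) (≤-trans (s≤s z≤n) 3≤b)) (from-no (2 ∣? 1)) }
    }

  triangleFree : ∀ {x y z} → Adj₃ x y → Adj₃ y z → ¬ Adj₃ z x
  triangleFree xy yz zx = contradiction
    (closedWalk₃-even {3} zx (snoc₃ 2 (snoc₃ 1 (snoc₃ 0 nil xy) yz) zx) 3≤b) (from-no (2 ∣? 3))

  walkAlong : (v : Fin (suc ℓ) → Fin (n ^ suc size)) → (∀ i → Adj₃ (v (inject₁ i)) (v (suc i))) →
    Walk (3 * ℓ) (tuple (v zero)) (tuple (v (fromℕ ℓ)))
  walkAlong {zero}  v st = nil
  walkAlong {suc ℓ} v st = snoc₃ ℓ (walkAlong (v ∘ inject₁) (st ∘ inject₁)) (st (fromℕ ℓ))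

  noOddCycle : NoOddCycleUpTo b graph
  noOddCycle ℓ _ ℓ<b odd c = odd (closedWalk₃-even {suc ℓ} (Cycle.close c)
    (snoc₃ ℓ (walkAlong (Path.vertex p) (Path.step p)) (Cycle.close c)) ℓ<b)
    where p = Cycle.path c

  -- Tuples are coloured through their codes; decoding returns them only pointwise, hence
  -- `shift-resp`.
  graph-not-orientable : ¬ Colouring (Shift {n} {size}) 3 → ¬ SemiTransitivelyOrientable graph
  graph-not-orientable uncolourable sto = uncolourable (f ∘ funToFin , λ {x} {y} xy → proper
    (inj₁ (shift-resp (sym ∘ finToFun-funToFin x) (sym ∘ finToFun-funToFin y) xy)))
    where
    colouring = orientable⇒3-colourable graph E E? E-sym triangleFree
      (λ xy yz zw → _ , _ , xy , yz , zw) sto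
    f = proj₁ colouring
    proper = proj₂ colouring

theorem1p13 : (k : ℕ) → 1 ≤ k →
    ∃ λ (n : ℕ) → Σ (Graph n) λ G →
    SemiTransitivelyOrientable G ×
    NoOddCycleUpTo (2 * k + 1) G ×
    (Σ (Fin n) λ u → Σ (Fin n) λ v → Σ (u ≢ v) λ u≢v →
    ¬ Graph.Adj G u v ×
    ¬ SemiTransitivelyOrientable (addEdge G u v u≢v))
theorem1p13 k 1≤k =
  -- `1 ≤ k` gives `3 ≤ b`, which excludes triangles in the tripled graph.
  let b = 2 * k + 1
      n , uncolourable = shift-uncolourable (3 * b) 3
      open Tripled n b (+-monoˡ-≤ 1 (*-monoʳ-≤ 2 1≤k))
      H , sto , H⊆graph , critical = criticalSubgraph graph (graph-not-orientable uncolourable)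
  in _ , H , sto , (λ ℓ 3≤ ≤b odd → noOddCycle ℓ 3≤ ≤b odd ∘ mapCycle H⊆graph) , critical
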